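{- Let $G$ be a finite simple semi-transitively orientable graph and let $e$ be an edge of $G$. If no subgraph of $G$ isomorphic to $K_4$ contains $e$, then the graph $G\setminus e$ obtained by deleting $e$ is semi-transitively orientable, and every graph obtained from $G$ by subdividing $e$ (i.e. replacing $e$ with a path of length at least $2$) is semi-transitively orientable.
   Context: Graphs are finite, undirected and simple. An orientation of a graph assigns to each edge one of its two directions; it is acyclic if it has no directed cycle. A digraph is transitive if whenever $v_1\to v_2$ and $v_2\to v_3$ are directed edges on three distinct vertices, $v_1\to v_3$ is also a directed edge. Given an acyclic orientation $\phi$ of a graph $G$, a shortcut in $\phi(G)$ is a non-transitive induced subdigraph of $\phi(G)$ on a vertex set $\{v_1,\dots,v_n\}$ with $n\ge 4$ (distinct vertices) that contains the directed path $v_1\to v_2\to\cdots\to v_n$ and the directed edge $v_1\to v_n$. An acyclic orientation $\phi$ is semi-transitive if $\phi(G)$ contains no shortcut, and a graph is semi-transitively orientable if it has a semi-transitive orientation. $G\setminus e$ denotes $G$ with the edge $e$ deleted (keeping all vertices). Subdividing $e=xy$ means deleting $e$ and adding a path $x,p_1,\dots,p_t,y$ with $t\ge 1$, where $p_1,\dots,p_t$ are new vertices. -}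

module Defs where

open import Data.Fin using (Fin; zero; toℕ; fromℕ)
open import Data.Fin.Properties using (inj⇒≟; +↔⊎) renaming (_≟_ to _≟ᶠ_)
open import Data.Nat using (ℕ; suc; _+_; _≤_)
open import Data.Nat.Properties using () renaming (_≟_ to _≟ⁿ_)
open import Data.Product using (Σ; Σ-syntax; ∃-syntax; _×_; _,_; swap)
open import Data.Sum using (_⊎_; inj₁; inj₂) renaming (swap to swap⊎)
open import Data.Sum.Function.Propositional using (_⊎-↔_)
open import Function using (_∘_; _on_; _↔_; _⇔_; Injective)
open import Function.Construct.Composition using (_↔-∘_)
open import Function.Construct.Identity using (↔-id)
open import Function.Construct.Symmetry using (↔-sym)
open import Function.Properties.Inverse using (↔⇒↣)
open import Level using (0ℓ)
open import Relation.Binary using (Rel; Symmetric; Asymmetric; Irreflexive; Decidable; DecidableEquality)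
open import Relation.Binary.PropositionalEquality using (_≡_; _≢_; refl; sym)
open import Relation.Nullary using (¬_; Dec)
open import Relation.Nullary.Decidable using (_×-dec_; _⊎-dec_; ¬?)
open import Relation.Unary using (Pred)

-- Adjacency is decidable, as is classically automatic.
record Graph (V : Set) : Set₁ where
  field
    size   : ℕ
    finite : V ↔ Fin size
    Adj    : Rel V 0ℓ
    adj?   : Decidable Adj
    symm   : Symmetric Adj
    irrefl : Irreflexive _≡_ Adj

  _≟_ : DecidableEquality V
  _≟_ = inj⇒≟ (↔⇒↣ finite)

-- An edge with its ends listed in an arbitrary order.
record Edge {V : Set} (G : Graph V) : Set where
  constructor edge
  field
    x y : V
    adj : Graph.Adj G x y

K : (m : ℕ) → Graph (Fin m)
K m = record
  { size   = m
  ; finite = ↔-id (Fin m)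
  ; Adj    = _≢_
  ; adj?   = λ i j → ¬? (i ≟ᶠ j)
  ; symm   = λ i≢j j≡i → i≢j (sym j≡i)
  ; irrefl = λ i≡j i≢j → i≢j i≡j
  }

record Subgraph {V : Set} (G : Graph V) : Set₁ where
  field
    Vertex : Pred V 0ℓ
    Adj    : Rel V 0ℓ
    symm   : Symmetric Adj
    ends   : ∀ {u v} → Adj u v → Vertex u × Vertex v
    sub    : ∀ {u v} → Adj u v → Graph.Adj G u v

-- The isomorphism is a map into the ambient vertex type, injective and with
-- image exactly the vertex set of the subgraph.
record _≅_ {V W : Set} {G : Graph V} (S : Subgraph G) (H : Graph W) : Set where
  field
    map       : W → V
    injective : Injective _≡_ _≡_ map
    image     : ∀ v → Subgraph.Vertex S v ⇔ (∃[ w ] map w ≡ v)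
    adjacency : ∀ w w′ → Graph.Adj H w w′ ⇔ Subgraph.Adj S (map w) (map w′)

_∈ᴱ_ : {V : Set} {G : Graph V} → Edge G → Subgraph G → Set
e ∈ᴱ S = Subgraph.Adj S (Edge.x e) (Edge.y e)

module _ {V : Set} (G : Graph V) (e : Edge G) where
  open Graph G
  open Edge e

  private
    IsE : Rel V 0ℓ
    IsE u v = (u ≡ x × v ≡ y) ⊎ (u ≡ y × v ≡ x)

    isE? : Decidable IsE
    isE? u v = ((u ≟ x) ×-dec (v ≟ y)) ⊎-dec ((u ≟ y) ×-dec (v ≟ x))

    isE-sym : Symmetric IsE
    isE-sym (inj₁ p) = inj₂ (swap p)
    isE-sym (inj₂ p) = inj₁ (swap p)

  delete : Graph V
  delete = record
    { size   = size
    ; finite = finite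
    ; Adj    = λ u v → Adj u v × ¬ IsE u v
    ; adj?   = λ u v → adj? u v ×-dec ¬? (isE? u v)
    ; symm   = λ (a , ¬e) → symm a , ¬e ∘ isE-sym
    ; irrefl = λ u≡v (a , _) → irrefl u≡v a
    }

  module _ (t : ℕ) where

    -- inj₂ i is the new vertex p_{i+1}; the new path is x, p₁, …, p_t, y.
    SubdivAdj : Rel (V ⊎ Fin t) 0ℓ
    SubdivAdj (inj₁ u) (inj₁ v) = Graph.Adj delete u v
    SubdivAdj (inj₁ u) (inj₂ i) = (u ≡ x × toℕ i ≡ 0) ⊎ (u ≡ y × suc (toℕ i) ≡ t)
    SubdivAdj (inj₂ i) (inj₁ u) = (u ≡ x × toℕ i ≡ 0) ⊎ (u ≡ y × suc (toℕ i) ≡ t)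
    SubdivAdj (inj₂ i) (inj₂ j) = (toℕ j ≡ suc (toℕ i)) ⊎ (toℕ i ≡ suc (toℕ j))

    private
      dec : Decidable SubdivAdj
      dec (inj₁ u) (inj₁ v) = Graph.adj? delete u v
      dec (inj₁ u) (inj₂ i) = ((u ≟ x) ×-dec (toℕ i ≟ⁿ 0)) ⊎-dec ((u ≟ y) ×-dec (suc (toℕ i) ≟ⁿ t))
      dec (inj₂ i) (inj₁ u) = ((u ≟ x) ×-dec (toℕ i ≟ⁿ 0)) ⊎-dec ((u ≟ y) ×-dec (suc (toℕ i) ≟ⁿ t))
      dec (inj₂ i) (inj₂ j) = (toℕ j ≟ⁿ suc (toℕ i)) ⊎-dec (toℕ i ≟ⁿ suc (toℕ j))

      sy : Symmetric SubdivAdj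
      sy {inj₁ u} {inj₁ v} a = Graph.symm delete a
      sy {inj₁ u} {inj₂ i} a = a
      sy {inj₂ i} {inj₁ u} a = a
      sy {inj₂ i} {inj₂ j} a = swap⊎ a

      n≢1+n : ∀ {n : ℕ} → n ≢ suc n
      n≢1+n ()

      irr : Irreflexive _≡_ SubdivAdj
      irr {inj₁ u} refl a        = Graph.irrefl delete refl a
      irr {inj₂ i} refl (inj₁ p) = n≢1+n p
      irr {inj₂ i} refl (inj₂ p) = n≢1+n p

    subdivide : Graph (V ⊎ Fin t)
    subdivide = record
      { size   = size + t
      ; finite = ↔-sym +↔⊎ ↔-∘ (finite ⊎-↔ ↔-id (Fin t))
      ; Adj    = SubdivAdj
      ; adj?   = dec
      ; symm   = λ {u} {v} → sy {u} {v}
      ; irrefl = irr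
      }

record Orientation {V : Set} (G : Graph V) : Set₁ where
  field
    Arc    : Rel V 0ℓ
    sound  : ∀ {u v} → Arc u v → Graph.Adj G u v
    orient : ∀ {u v} → Graph.Adj G u v → Arc u v ⊎ Arc v u
    asym   : Asymmetric Arc

-- Weaker than transitivity of the relation: the three vertices are distinct.
TransitiveDigraph : {A : Set} → Rel A 0ℓ → Set
TransitiveDigraph _⟶_ =
  ∀ {u v w} → u ≢ v → v ≢ w → u ≢ w → u ⟶ v → v ⟶ w → u ⟶ w

-- A directed path with k arcs, on k + 1 distinct vertices.
record DirectedPath {V : Set} (_⟶_ : Rel V 0ℓ) (k : ℕ) : Set where
  field
    vertex   : Fin (suc k) → V
    distinct : Injective _≡_ _≡_ vertex
    step     : ∀ i j → toℕ j ≡ suc (toℕ i) → vertex i ⟶ vertex j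

  first last : V
  first = vertex zero
  last  = vertex (fromℕ k)

DirectedCycle : {V : Set} → Rel V 0ℓ → Set
DirectedCycle _⟶_ =
  ∃[ k ] Σ[ p ∈ DirectedPath _⟶_ k ] DirectedPath.last p ⟶ DirectedPath.first p

Acyclic : {V : Set} → Rel V 0ℓ → Set
Acyclic _⟶_ = ¬ DirectedCycle _⟶_

-- As the vertices of the path are distinct, the subdigraph they induce is the
-- pullback of the arc relation along their enumeration.
record Shortcut {V : Set} (_⟶_ : Rel V 0ℓ) : Set where
  field
    k             : ℕ
    path          : DirectedPath _⟶_ k
    atLeast4      : 4 ≤ suc k
    shortcutEdge  : DirectedPath.first path ⟶ DirectedPath.last path
    nonTransitive : ¬ TransitiveDigraph (_⟶_ on DirectedPath.vertex path)

record SemiTransitive {V : Set} {G : Graph V} (φ : Orientation G) : Set where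
  open Orientation φ
  field
    acyclic    : Acyclic Arc
    noShortcut : ¬ Shortcut Arc

SemiTransitivelyOrientable : {V : Set} → Graph V → Set₁
SemiTransitivelyOrientable G = Σ (Orientation G) SemiTransitive

{-# OPTIONS --safe #-}

-- Reversing all arcs if necessary, let e be oriented x → y. In a semi-transitive orientation a
-- walk on at least four vertices whose ends are joined by an arc spans a clique. Hence, if there
-- is a w with x → w → y, an arc a → b with a ⇝ x and y ⇝ b must be e itself: otherwise the walk
-- a ⇝ x → w → y ⇝ b puts e in a K₄. A shortcut created by deleting e would contain such an arc
-- together with such a w. For the subdivision, if some w exists, orient the new path from x to y:
-- a shortcut meeting it would run through it whole, and its arc from first to last vertex would
-- be such an a → b. If no w exists, e is the only directed walk from x to y, and the orientation
-- x → p₁ ← p₂ ← ⋯ ← p_t ← y works: a shortcut meeting the new path would have to end at p₁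
-- and start at x, reaching y by another walk.
module Submission where

open import Defs
open import Data.Empty using (⊥; ⊥-elim)
open import Data.Fin using (Fin; zero; suc; toℕ; fromℕ; inject₁; opposite)
open import Data.Fin.Properties as Fin using (any?; toℕ<n; toℕ-injective)
open import Data.List using ([]; _∷_; lookup)
open import Data.List.Membership.Propositional.Properties using (∈-lookup)
open import Data.List.Relation.Unary.All as All using ([]; _∷_)
open import Data.List.Relation.Unary.AllPairs using (AllPairs; []; _∷_)
open import Data.Nat using (ℕ; zero; suc; _+_; _≤_; _<_; _>_; z≤n; s≤s; z<s; s<s; s≤s⁻¹; s<s⁻¹)
open import Data.Nat.Properties as ℕ using ()
open import Data.Product using (Σ-syntax; ∃; ∃-syntax; _×_; _,_; proj₁; proj₂)
open import Data.Sum as Sum using (_⊎_; inj₁; inj₂)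
open import Function using (id; _∘_; _on_; flip; Injective; Inverse; mk⇔)
open import Level using (0ℓ)
open import Relation.Binary using (Rel; _⇒_; Symmetric; Transitive; Decidable; DecidableEquality; tri<; tri≈; tri>)
open import Relation.Binary.Construct.Closure.ReflexiveTransitive using (Star; ε; _◅_; _◅◅_; return; kleisliStar)
open import Relation.Binary.PropositionalEquality using (_≡_; _≢_; refl; sym; trans; cong; subst; subst₂)
open import Relation.Nullary using (¬_; Dec; yes; no)
open import Relation.Nullary.Decidable using (_×-dec_; decidable-stable; map′)

-- Directed paths, walks and acyclicity.

-- Transitivity is asked for increasing triples only, so that `TransitiveDigraph`, which is
-- restricted to distinct vertices, can supply it.
stepwise : ∀ {n} (R : Rel (Fin n) 0ℓ) →
  (∀ i j → toℕ j ≡ suc (toℕ i) → R i j) →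
  (∀ {i j l} → toℕ i < toℕ j → toℕ j < toℕ l → R i j → R j l → R i l) →
  ∀ {i j} → toℕ i < toℕ j → R i j
stepwise R step tr {zero}  {suc zero}    _   = step zero (suc zero) refl
stepwise R step tr {zero}  {suc (suc j)} _   =
  tr z<s (s<s z<s) (step zero (suc zero) refl)
    (stepwise (R on suc) (λ i j → step (suc i) (suc j) ∘ cong suc)
      (λ p q → tr (s<s p) (s<s q)) {zero} {suc j} z<s)
stepwise R step tr {suc i} {suc j}       i<j =
  stepwise (R on suc) (λ i j → step (suc i) (suc j) ∘ cong suc)
    (λ p q → tr (s<s p) (s<s q)) (s<s⁻¹ i<j)

module _ {V : Set} {_⟶_ : Rel V 0ℓ} where

  open DirectedPath

  path-related : (_≺_ : Rel V 0ℓ) → Transitive _≺_ → _⟶_ ⇒ _≺_ →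
    ∀ {k} (p : DirectedPath _⟶_ k) {i j} → toℕ i < toℕ j → vertex p i ≺ vertex p j
  path-related _≺_ ≺-trans ⟶⇒≺ p =
    stepwise (_≺_ on vertex p) (λ i j → ⟶⇒≺ ∘ step p i j) (λ _ _ → ≺-trans)

  strictOrder⇒acyclic : (_≺_ : Rel V 0ℓ) → Transitive _≺_ → (∀ {u} → ¬ (u ≺ u)) →
    _⟶_ ⇒ _≺_ → Acyclic _⟶_
  -- A directed cycle on one vertex is a loop, and its path contributes no arc.
  strictOrder⇒acyclic _≺_ ≺-trans ≺-irrefl ⟶⇒≺ (zero  , p , back) = ≺-irrefl (⟶⇒≺ back)
  strictOrder⇒acyclic _≺_ ≺-trans ≺-irrefl ⟶⇒≺ (suc k , p , back) =
    ≺-irrefl (≺-trans (path-related _≺_ ≺-trans ⟶⇒≺ p {zero} {fromℕ (suc k)} z<s) (⟶⇒≺ back))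

  path-walk : ∀ {k} (p : DirectedPath _⟶_ k) {i j} → toℕ i ≤ toℕ j →
    Star _⟶_ (vertex p i) (vertex p j)
  path-walk p {i} {j} i≤j with ℕ.m≤n⇒m<n∨m≡n i≤j
  ... | inj₁ i<j = path-related (Star _⟶_) _◅◅_ return p i<j
  ... | inj₂ i≡j = subst (λ l → Star _⟶_ (vertex p i) (vertex p l)) (toℕ-injective i≡j) ε

  first-walk : ∀ {k} (p : DirectedPath _⟶_ k) i → Star _⟶_ (first p) (vertex p i)
  first-walk p i = path-walk p {zero} {i} z≤n

  last-walk : ∀ {k} (p : DirectedPath _⟶_ k) i → Star _⟶_ (vertex p i) (last p)
  last-walk p i = path-walk p (Fin.≤fromℕ i)

  len : ∀ {u v} → Star _⟶_ u v → ℕ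
  len ε       = 0
  len (_ ◅ s) = suc (len s)

  at : ∀ {u v} (s : Star _⟶_ u v) → Fin (suc (len s)) → V
  at {u} _       zero    = u
  at     (_ ◅ s) (suc i) = at s i

  at-last : ∀ {u v} (s : Star _⟶_ u v) → at s (fromℕ (len s)) ≡ v
  at-last ε       = refl
  at-last (_ ◅ s) = at-last s

  at-step : ∀ {u v} (s : Star _⟶_ u v) i j → toℕ j ≡ suc (toℕ i) → at s i ⟶ at s j
  at-step (a ◅ s) zero    (suc zero) _  = a
  at-step (a ◅ s) (suc i) (suc j)    eq = at-step s i j (ℕ.suc-injective eq)

  toPath : ∀ {u v} (s : Star _⟶_ u v) → Injective _≡_ _≡_ (at s) → DirectedPath _⟶_ (len s)
  toPath s inj = record { vertex = at s ; distinct = inj ; step = at-step s }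

  drop : ∀ {u v} (s : Star _⟶_ u v) i → Star _⟶_ (at s i) v
  drop s       zero    = s
  drop (_ ◅ s) (suc i) = drop s i

  drop-injective : ∀ {u v} (s : Star _⟶_ u v) → Injective _≡_ _≡_ (at s) →
    ∀ i → Injective _≡_ _≡_ (at (drop s i))
  drop-injective s       inj zero    = inj
  drop-injective (_ ◅ s) inj (suc i) = drop-injective s (Fin.suc-injective ∘ inj) i

  -- Induction on the walk: if its start recurs in the simple tail, the part of that tail from the
  -- recurrence on already joins the same ends.
  simpleWalk : DecidableEquality V → ∀ {u v} → Star _⟶_ u v →
    Σ[ s ∈ Star _⟶_ u v ] Injective _≡_ _≡_ (at s)
  simpleWalk _≟_ ε = ε , λ { {zero} {zero} _ → refl }
  simpleWalk _≟_ {u} (a ◅ s) with simpleWalk _≟_ s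
  ... | s′ , inj with any? (λ i → at s′ i ≟ u)
  ...   | yes (i , refl) = drop s′ i , drop-injective s′ inj i
  ...   | no  u∉s′       = a ◅ s′ , λ
    { {zero}  {zero}  _  → refl
    ; {zero}  {suc j} eq → ⊥-elim (u∉s′ (j , sym eq))
    ; {suc i} {zero}  eq → ⊥-elim (u∉s′ (i , eq))
    ; {suc i} {suc j} eq → cong suc (inj eq)
    }

  -- `Acyclic` speaks of cycles on distinct vertices; shortening the returning walk to a simple one
  -- produces such a cycle.
  acyclic⇒noClosedWalk : DecidableEquality V → Acyclic _⟶_ →
    ∀ {u v} → u ⟶ v → ¬ Star _⟶_ v u
  acyclic⇒noClosedWalk _≟_ acyclic a s with simpleWalk _≟_ s
  ... | s′ , inj = acyclic (len s′ , toPath s′ inj , subst (_⟶ _) (sym (at-last s′)) a)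

  infix 4 _∈ʷ_
  _∈ʷ_ : V → ∀ {u v} → Star _⟶_ u v → Set
  z ∈ʷ s = ∃[ i ] at s i ≡ z

  start∈ : ∀ {u v} (s : Star _⟶_ u v) → u ∈ʷ s
  start∈ s = zero , refl

  end∈ : ∀ {u v} (s : Star _⟶_ u v) → v ∈ʷ s
  end∈ s = fromℕ (len s) , at-last s

  ∈-◅ : ∀ {z u v w} (a : u ⟶ w) (s : Star _⟶_ w v) → z ∈ʷ s → z ∈ʷ a ◅ s
  ∈-◅ a s (i , eq) = suc i , eq

  ∈-◅◅ʳ : ∀ {z u v w} (s : Star _⟶_ u w) (s′ : Star _⟶_ w v) → z ∈ʷ s′ → z ∈ʷ s ◅◅ s′
  ∈-◅◅ʳ ε       s′ z∈ = z∈
  ∈-◅◅ʳ (a ◅ s) s′ z∈ = ∈-◅ a (s ◅◅ s′) (∈-◅◅ʳ s s′ z∈)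

  len-◅◅ : ∀ {u v w} (s : Star _⟶_ u w) (s′ : Star _⟶_ w v) → len (s ◅◅ s′) ≡ len s + len s′
  len-◅◅ ε       s′ = refl
  len-◅◅ (a ◅ s) s′ = cong suc (len-◅◅ s s′)

  len>0 : ∀ {u v} (s : Star _⟶_ u v) → u ≢ v → 0 < len s
  len>0 ε       u≢u = ⊥-elim (u≢u refl)
  len>0 (_ ◅ s) _   = z<s

-- Cliques as copies of complete graphs, and decidability.

allPairs-lookup : {A : Set} {R : Rel A 0ℓ} → Symmetric R → ∀ {xs} → AllPairs R xs →
  ∀ {i j} → i ≢ j → R (lookup xs i) (lookup xs j)
allPairs-lookup R-sym (_  ∷ _)  {zero}  {zero}  i≢j = ⊥-elim (i≢j refl)
allPairs-lookup R-sym (px ∷ _)  {zero}  {suc j} _   = All.lookup px (∈-lookup j)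
allPairs-lookup R-sym (px ∷ _)  {suc i} {zero}  _   = R-sym (All.lookup px (∈-lookup i))
allPairs-lookup R-sym (_  ∷ ps) {suc i} {suc j} i≢j = allPairs-lookup R-sym ps (i≢j ∘ cong suc)

module _ {V : Set} {G : Graph V} where

  open Graph G

  inducedOnImage : ∀ {m} → (Fin m → V) → Subgraph G
  inducedOnImage f = record
    { Vertex = λ v → ∃[ i ] f i ≡ v
    ; Adj    = λ u v → Adj u v × (∃[ i ] f i ≡ u) × (∃[ i ] f i ≡ v)
    ; symm   = λ (a , p , q) → symm a , q , p
    ; ends   = proj₂
    ; sub    = proj₁
    }

  clique≅K : ∀ {m} (f : Fin m → V) → (∀ {i j} → i ≢ j → Adj (f i) (f j)) →
    inducedOnImage f ≅ K m
  clique≅K f adj = record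
    { map       = f
    -- Distinct indices have adjacent images, and no vertex is adjacent to itself.
    ; injective = λ {i} {j} fi≡fj → decidable-stable (i Fin.≟ j) λ i≢j → irrefl fi≡fj (adj i≢j)
    ; image     = λ _ → mk⇔ id id
    ; adjacency = λ i j → mk⇔ (λ i≢j → adj i≢j , (i , refl) , (j , refl))
                              (λ (a , _) i≡j → irrefl (cong f i≡j) a)
    }

  K₄-containing : (e : Edge G) → ∀ {a b} →
    AllPairs Adj (Edge.x e ∷ Edge.y e ∷ a ∷ b ∷ []) → Σ[ S ∈ Subgraph G ] (S ≅ K 4 × e ∈ᴱ S)
  K₄-containing e {a} {b} ps =
    inducedOnImage f , clique≅K f (allPairs-lookup symm ps) ,
    (Edge.adj e , (zero , refl) , (suc zero , refl))
    where f = lookup (Edge.x e ∷ Edge.y e ∷ a ∷ b ∷ [])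

  arc? : (φ : Orientation G) → Decidable (Orientation.Arc φ)
  arc? φ u v with adj? u v
  ... | no ¬a = no (¬a ∘ Orientation.sound φ)
  ... | yes a with Orientation.orient φ a
  ...   | inj₁ u→v = yes u→v
  ...   | inj₂ v→u = no (Orientation.asym φ v→u)

  ∃? : {P : V → Set} → (∀ v → Dec (P v)) → Dec (∃ P)
  ∃? {P} P? = map′ (λ (i , p) → from i , p)
                   (λ (v , p) → to v , subst P (sym (strictlyInverseʳ v)) p)
                   (any? (P? ∘ from))
    where open Inverse finite

  converse : Orientation G → Orientation G
  converse φ = record
    { Arc    = flip Arc
    ; sound  = symm ∘ sound
    ; orient = Sum.swap ∘ orient
    ; asym   = asym
    }
    where open Orientation φ

-- Reversal of paths and shortcuts.

module _ {V : Set} {_⟶_ : Rel V 0ℓ} where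

  open DirectedPath

  reversePath : ∀ {k} → DirectedPath _⟶_ k → DirectedPath (flip _⟶_) k
  reversePath {k} p = record
    { vertex   = vertex p ∘ opposite
    ; distinct = λ {i} {j} eq → trans (sym (Fin.opposite-involutive i))
        (trans (cong opposite (distinct p eq)) (Fin.opposite-involutive j))
    ; step     = λ i j j≡1+i → step p (opposite j) (opposite i) (opposite-pred i j j≡1+i)
    }
    where
    opposite-pred : ∀ (i j : Fin (suc k)) → toℕ j ≡ suc (toℕ i) →
      toℕ (opposite i) ≡ suc (toℕ (opposite j))
    opposite-pred i j j≡1+i rewrite Fin.opposite-prop i | Fin.opposite-prop j | j≡1+i =
      ℕ.+-∸-assoc 1 (subst (_≤ k) j≡1+i (Fin.toℕ≤pred[n] j))

module _ {V : Set} {_⟶_ : Rel V 0ℓ} where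

  open DirectedPath

  reverseShortcut : Shortcut (flip _⟶_) → Shortcut _⟶_
  reverseShortcut s = record
    { k             = k
    ; path          = reversePath {_⟶_ = flip _⟶_} path
    ; atLeast4      = atLeast4
    ; shortcutEdge  = subst (λ i → last path ⟶ vertex path i)
                        (sym (Fin.opposite-involutive zero)) shortcutEdge
    -- Transitivity is self-dual: a triple `i`, `j`, `l` is read backwards through `opposite`.
    ; nonTransitive = λ tr → nonTransitive λ {i} {j} {l} i≢j j≢l i≢l j⟶i l⟶j →
        subst₂ R (inv l) (inv i)
          (tr (j≢l ∘ sym ∘ opposite-injective) (i≢j ∘ sym ∘ opposite-injective)
              (i≢l ∘ sym ∘ opposite-injective)
              (subst₂ R (sym (inv l)) (sym (inv j)) l⟶j)
              (subst₂ R (sym (inv j)) (sym (inv i)) j⟶i))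
    }
    where
    open Shortcut s
    R = _⟶_ on vertex path
    inv = Fin.opposite-involutive {suc k}
    opposite-injective : ∀ {i j : Fin (suc k)} → opposite i ≡ opposite j → i ≡ j
    opposite-injective {i} {j} eq = trans (sym (inv i)) (trans (cong opposite eq) (inv j))

-- Walks and cliques in a semi-transitive orientation.

module SemiTransitiveProperties {V : Set} {G : Graph V} {φ : Orientation G}
  (φ-st : SemiTransitive φ) where

  open Graph G
  open Orientation φ public
  open SemiTransitive φ-st public

  noClosedWalk : ∀ {u v} → Arc u v → ¬ Star Arc v u
  noClosedWalk = acyclic⇒noClosedWalk _≟_ acyclic

  walk-antisym : ∀ {u v} → Star Arc u v → Star Arc v u → u ≡ v
  walk-antisym ε       _  = refl
  walk-antisym (a ◅ s) s′ = ⊥-elim (noClosedWalk a (s ◅◅ s′))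

  arc⇒≢ : ∀ {u v} → Arc u v → u ≢ v
  arc⇒≢ a u≡v = irrefl u≡v (sound a)

  _≺_ : Rel V 0ℓ
  u ≺ v = Star Arc u v × u ≢ v

  ≺-trans : Transitive _≺_
  ≺-trans (s , u≢v) (s′ , _) =
    s ◅◅ s′ , λ { refl → u≢v (walk-antisym s s′) }

  arc⇒≺ : Arc ⇒ _≺_
  arc⇒≺ a = return a , arc⇒≢ a

  at-≺ : ∀ {u v} (s : Star Arc u v) {i j} → toℕ i < toℕ j → at s i ≺ at s j
  at-≺ s = stepwise (_≺_ on at s) (λ i j → arc⇒≺ ∘ at-step s i j) (λ _ _ → ≺-trans)

  -- `_≺_` strictly increases along a walk. Every walk is thus a directed path as it stands, and
  -- none of its vertices is lost to shortening.
  at-injective : ∀ {u v} (s : Star Arc u v) → Injective _≡_ _≡_ (at s)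
  at-injective s {i} {j} eq with Fin.<-cmp i j
  ... | tri< i<j _ _ = ⊥-elim (proj₂ (at-≺ s i<j) eq)
  ... | tri≈ _ i≡j _ = i≡j
  ... | tri> _ _ j<i = ⊥-elim (proj₂ (at-≺ s j<i) (sym eq))

  converse-semiTransitive : SemiTransitive (converse φ)
  converse-semiTransitive = record
    { acyclic    = strictOrder⇒acyclic (flip _≺_) (flip ≺-trans) (λ (_ , u≢u) → u≢u refl)
                     arc⇒≺
    ; noShortcut = noShortcut ∘ reverseShortcut
    }

  module _ {k} (p : DirectedPath Arc k) (3≤k : 3 ≤ k)
           (a : Arc (DirectedPath.first p) (DirectedPath.last p)) where

    open DirectedPath p

    -- If two vertices of the path were not adjacent, the induced subdigraph would not be
    -- transitive, since transitivity extends the consecutive arcs to all increasing pairs. The path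
    -- would then be a shortcut.
    path-adjacent : ∀ {i j} → toℕ i < toℕ j → Adj (vertex i) (vertex j)
    path-adjacent {i} {j} i<j = decidable-stable (adj? (vertex i) (vertex j)) λ ¬adj →
      noShortcut record
        { k             = k
        ; path          = p
        ; atLeast4      = s≤s 3≤k
        ; shortcutEdge  = a
        ; nonTransitive = λ tr → ¬adj (sound (stepwise (Arc on vertex) step
            (λ i<j j<l → tr (Fin.<⇒≢ i<j) (Fin.<⇒≢ j<l) (Fin.<⇒≢ (ℕ.<-trans i<j j<l))) i<j))
        }

    path-clique : ∀ {i j} → i ≢ j → Adj (vertex i) (vertex j)
    path-clique {i} {j} i≢j with Fin.<-cmp i j
    ... | tri< i<j _ _ = path-adjacent i<j
    ... | tri≈ _ i≡j _ = ⊥-elim (i≢j i≡j)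
    ... | tri> _ _ j<i = symm (path-adjacent j<i)

  walk-clique : ∀ {u v} (s : Star Arc u v) → 3 ≤ len s → Arc u v →
    ∀ {p q} → p ∈ʷ s → q ∈ʷ s → p ≢ q → Adj p q
  walk-clique s 3≤len a (i , refl) (j , refl) p≢q =
    path-clique (toPath s (at-injective s)) 3≤len (subst (Arc _) (sym (at-last s)) a)
      {i} {j} (p≢q ∘ cong (at s))

  -- A detour with at least three arcs spans a clique together with the arc from x to y, so w and y
  -- are adjacent. An arc w → y makes w a middle vertex, and an arc y → w closes a walk.
  noDetour : ∀ {x y w} → Arc x y → ¬ (∃[ z ] Arc x z × Arc z y) →
    Arc x w → Star Arc w y → ¬ (w ≢ y)
  noDetour xy noMiddle xw ε                  w≢y = w≢y refl
  noDetour xy noMiddle xw (wz ◅ ε)           w≢y = noMiddle (_ , xw , wz)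
  noDetour xy noMiddle xw s@(_ ◅ (_ ◅ _)) w≢y
    with orient (walk-clique (xw ◅ s) (s≤s (s≤s (s≤s z≤n))) xy
                   (∈-◅ xw s (start∈ s)) (∈-◅ xw s (end∈ s)) w≢y)
  ... | inj₁ wy = noMiddle (_ , xw , wy)
  ... | inj₂ yw = noClosedWalk yw s

-- Arcs that span e, for e directed from x to y.

module DeleteSubdivide {V : Set} {G : Graph V} (e : Edge G)
  {φ : Orientation G} (φ-st : SemiTransitive φ)
  (xy : Orientation.Arc φ (Edge.x e) (Edge.y e))
  (noK₄ : ¬ (Σ[ S ∈ Subgraph G ] (S ≅ K 4 × e ∈ᴱ S))) where

  open Edge e
  open Graph G
  open SemiTransitiveProperties φ-st

  noOuterArc : ∀ {a b w} → Arc x w → Arc w y → Star Arc a x → Star Arc y b → Arc a b →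
    a ≡ x × b ≡ y
  noOuterArc {a} {b} {w} xw wy s s′ ab with a ≟ x | b ≟ y
  ... | yes a≡x | yes b≡y = a≡x , b≡y
  -- The clique is x, y, w, a: the walk has at least one arc before x and two from x to y.
  ... | no  a≢x | _       = ⊥-elim (noK₄ (K₄-containing e
      ( (adj ∷ sound xw ∷ symm (c a∈ x∈ a≢x) ∷ [])
      ∷ (symm (sound wy) ∷ symm (c a∈ y∈ a≢y) ∷ [])
      ∷ (symm (c a∈ w∈ a≢w) ∷ [])
      ∷ [] ∷ [])))
    where
    t = xw ◅ wy ◅ s′
    c : ∀ {p q} → p ∈ʷ s ◅◅ t → q ∈ʷ s ◅◅ t → p ≢ q → Adj p q
    c = walk-clique (s ◅◅ t)
          (subst (3 ≤_) (sym (len-◅◅ s t)) (ℕ.+-mono-≤ (len>0 s a≢x) (s≤s (s≤s z≤n)))) ab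
    a∈ = start∈ (s ◅◅ t)
    x∈ = ∈-◅◅ʳ s t (start∈ t)
    w∈ = ∈-◅◅ʳ s t (suc zero , refl)
    y∈ = ∈-◅◅ʳ s t (suc (suc zero) , refl)
    a≢w : a ≢ w
    a≢w refl = noClosedWalk xw s
    a≢y : a ≢ y
    a≢y refl = noClosedWalk xy s
  -- Now the walk starts at x and has at least one arc after y, so the clique is x, y, w, b.
  ... | yes refl | no b≢y = ⊥-elim (noK₄ (K₄-containing e
      ( (adj ∷ sound xw ∷ c x∈ b∈ x≢b ∷ [])
      ∷ (symm (sound wy) ∷ c y∈ b∈ (b≢y ∘ sym) ∷ [])
      ∷ (c w∈ b∈ w≢b ∷ [])
      ∷ [] ∷ [])))
    where
    t = xw ◅ wy ◅ s′
    c : ∀ {p q} → p ∈ʷ t → q ∈ʷ t → p ≢ q → Adj p q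
    c = walk-clique t (s≤s (s≤s (len>0 s′ (b≢y ∘ sym)))) ab
    b∈ = end∈ t
    x∈ = start∈ t
    w∈ : w ∈ʷ t
    w∈ = suc zero , refl
    y∈ : y ∈ʷ t
    y∈ = suc (suc zero) , refl
    w≢b : w ≢ b
    w≢b refl = noClosedWalk wy s′
    x≢b : x ≢ b
    x≢b refl = noClosedWalk xy s′

  -- Deleting e.

  deleteOrientation : Orientation (delete G e)
  deleteOrientation = record
    { Arc    = λ u v → Arc u v × Graph.Adj (delete G e) u v
    ; sound  = proj₂
    ; orient = λ {u} {v} a → Sum.map (_, a) (_, Graph.symm (delete G e) {u} {v} a) (orient (proj₁ a))
    ; asym   = λ (a , _) (a′ , _) → asym a a′
    }

  private
    Arcᵈ = Orientation.Arc deleteOrientation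

  arcᵈ-intro : ∀ {u v} → Arc u v → ¬ (u ≡ x × v ≡ y) → Arcᵈ u v
  arcᵈ-intro a ¬xy = a , sound a , λ { (inj₁ eqs) → ¬xy eqs ; (inj₂ (refl , refl)) → asym a xy }

  arcᵈ≢e : ∀ {u v} → Arcᵈ u v → ¬ (u ≡ x × v ≡ y)
  arcᵈ≢e (_ , _ , ¬e) eqs = ¬e (inj₁ eqs)

  delete-acyclic : Acyclic Arcᵈ
  delete-acyclic = strictOrder⇒acyclic _≺_ ≺-trans (λ (_ , u≢u) → u≢u refl) (arc⇒≺ ∘ proj₁)

  -- The same path is a shortcut of `φ` unless its transitivity there relies on e as the arc from
  -- `i` to `l`. In that case vertex `j` is a middle vertex between x and y, so by `noOuterArc` the
  -- shortcut edge is e, which has been deleted.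
  delete-noShortcut : ¬ Shortcut Arcᵈ
  delete-noShortcut s = noShortcut record
    { k             = k
    ; path          = p
    ; atLeast4      = atLeast4
    ; shortcutEdge  = proj₁ shortcutEdge
    ; nonTransitive = λ tr → nonTransitive λ {i} {j} {l} i≢j j≢l i≢l i→j j→l →
        arcᵈ-intro (tr i≢j j≢l i≢l (proj₁ i→j) (proj₁ j→l)) λ { (vi≡x , vl≡y) →
          arcᵈ≢e shortcutEdge
            (noOuterArc (subst (λ z → Arc z _) vi≡x (proj₁ i→j)) (subst (Arc _) vl≡y (proj₁ j→l))
              (subst (Star Arc _) vi≡x (first-walk p i))
              (subst (λ z → Star Arc z _) vl≡y (last-walk p l))
              (proj₁ shortcutEdge)) }
    }
    where
    open Shortcut s
    open DirectedPath path
    p : DirectedPath Arc k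
    p = record { vertex = vertex ; distinct = distinct ; step = λ i j → proj₁ ∘ step i j }

  delete-semiTransitive : SemiTransitive deleteOrientation
  delete-semiTransitive = record { acyclic = delete-acyclic ; noShortcut = delete-noShortcut }

  -- Subdividing e: orientations of the new path and their acyclicity.

  -- The subdivided path is oriented x → p₁, and along _↝_ on the positions of p₁, …, p_t, y,
  -- which are 0, …, t.
  module Subdivide (t : ℕ) (_↝_ _⊏_ : Rel ℕ 0ℓ)
    (↝-sound : ∀ {a b} → a ↝ b → b ≡ suc a ⊎ a ≡ suc b)
    (↝-total : ∀ {a b} → b ≡ suc a → a ↝ b ⊎ b ↝ a)
    (⊏-trans : Transitive _⊏_) (⊏-irrefl : ∀ {a} → ¬ (a ⊏ a)) (↝⇒⊏ : _↝_ ⇒ _⊏_) where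

    G′ : Graph (V ⊎ Fin t)
    G′ = subdivide G e t

    Arcˢ : Rel (V ⊎ Fin t) 0ℓ
    Arcˢ (inj₁ u) (inj₁ v) = Arcᵈ u v
    Arcˢ (inj₁ u) (inj₂ i) = (u ≡ x × toℕ i ≡ 0) ⊎ (u ≡ y × t ↝ toℕ i)
    Arcˢ (inj₂ i) (inj₁ u) = u ≡ y × toℕ i ↝ t
    Arcˢ (inj₂ i) (inj₂ j) = toℕ i ↝ toℕ j

    -- Collapsing the new vertices into y turns x → p₁ into x → y and every other arc of the new
    -- path into the empty walk, so walks of `Arcˢ` become walks of `Arc`.
    contract : V ⊎ Fin t → V
    contract (inj₁ u) = u
    contract (inj₂ _) = y

    -- Among the old vertices only the position of y matters.
    position : V ⊎ Fin t → ℕ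
    position (inj₁ _) = t
    position (inj₂ i) = toℕ i

    -- A lexicographic order: reachability of the contractions first, then positions to break ties
    -- among p₁, ..., p_t, y.
    _≺ˢ_ : Rel (V ⊎ Fin t) 0ℓ
    u ≺ˢ v = Star Arc (contract u) (contract v) × (contract u ≡ contract v → position u ⊏ position v)

    ≺ˢ-trans : Transitive _≺ˢ_
    ≺ˢ-trans (s , p) (s′ , p′) = s ◅◅ s′ , λ eq →
      let eq′ = walk-antisym s (subst (Star Arc _) (sym eq) s′)
      in ⊏-trans (p eq′) (p′ (trans (sym eq′) eq))

    ≺ˢ-irrefl : ∀ {u} → ¬ (u ≺ˢ u)
    ≺ˢ-irrefl (_ , p) = ⊏-irrefl (p refl)

    arcˢ⇒≺ˢ : Arcˢ ⇒ _≺ˢ_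
    arcˢ⇒≺ˢ {inj₁ u} {inj₁ v} (a , _)           = return a , ⊥-elim ∘ arc⇒≢ a
    arcˢ⇒≺ˢ {inj₁ u} {inj₂ i} (inj₁ (refl , _)) = return xy , ⊥-elim ∘ arc⇒≢ xy
    arcˢ⇒≺ˢ {inj₁ u} {inj₂ i} (inj₂ (refl , r)) = ε , λ _ → ↝⇒⊏ r
    arcˢ⇒≺ˢ {inj₂ i} {inj₁ u} (refl , r)        = ε , λ _ → ↝⇒⊏ r
    arcˢ⇒≺ˢ {inj₂ i} {inj₂ j} r                 = ε , λ _ → ↝⇒⊏ r

    arcˢ-asym : ∀ {u v} → Arcˢ u v → ¬ Arcˢ v u
    arcˢ-asym {u} {v} a a′ = ≺ˢ-irrefl {u} (≺ˢ-trans {u} {v} {u} (arcˢ⇒≺ˢ {u} {v} a) (arcˢ⇒≺ˢ {v} {u} a′))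

    -- New vertices have positions below `t`, so on the new path y can only be joined to p_t.
    t≢1+ : ∀ (i : Fin t) → toℕ i ≢ suc t
    t≢1+ i eq = ℕ.<-asym (toℕ<n i) (subst (t <_) (sym eq) (ℕ.n<1+n t))

    arcˢ-sound : ∀ {u v} → Arcˢ u v → Graph.Adj G′ u v
    arcˢ-sound {inj₁ u} {inj₁ v} (_ , a)           = a
    arcˢ-sound {inj₁ u} {inj₂ i} (inj₁ eqs)        = inj₁ eqs
    arcˢ-sound {inj₁ u} {inj₂ i} (inj₂ (u≡y , r)) with ↝-sound r
    ... | inj₁ i≡1+t = ⊥-elim (t≢1+ i i≡1+t)
    ... | inj₂ t≡1+i = inj₂ (u≡y , sym t≡1+i)
    arcˢ-sound {inj₂ i} {inj₁ u} (u≡y , r) with ↝-sound r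
    ... | inj₁ t≡1+i = inj₂ (u≡y , sym t≡1+i)
    ... | inj₂ i≡1+t = ⊥-elim (t≢1+ i i≡1+t)
    arcˢ-sound {inj₂ i} {inj₂ j} r = ↝-sound r

    arcˢ-orient : ∀ {u v} → Graph.Adj G′ u v → Arcˢ u v ⊎ Arcˢ v u
    arcˢ-orient {inj₁ u} {inj₁ v} a                 = Orientation.orient deleteOrientation a
    arcˢ-orient {inj₁ u} {inj₂ i} (inj₁ eqs)        = inj₁ (inj₁ eqs)
    arcˢ-orient {inj₁ u} {inj₂ i} (inj₂ (u≡y , eq)) =
      Sum.swap (Sum.map (u≡y ,_) (inj₂ ∘ (u≡y ,_)) (↝-total (sym eq)))
    arcˢ-orient {inj₂ i} {inj₁ u} (inj₁ eqs)        = inj₂ (inj₁ eqs)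
    arcˢ-orient {inj₂ i} {inj₁ u} (inj₂ (u≡y , eq)) =
      Sum.map (u≡y ,_) (inj₂ ∘ (u≡y ,_)) (↝-total (sym eq))
    arcˢ-orient {inj₂ i} {inj₂ j} (inj₁ eq)         = ↝-total eq
    arcˢ-orient {inj₂ i} {inj₂ j} (inj₂ eq)         = Sum.swap (↝-total eq)

    subdivideOrientation : Orientation G′
    subdivideOrientation = record
      { Arc    = Arcˢ
      ; sound  = λ {u} {v} → arcˢ-sound {u} {v}
      ; orient = λ {u} {v} → arcˢ-orient {u} {v}
      ; asym   = λ {u} {v} → arcˢ-asym {u} {v}
      }

    contractWalk : ∀ {u v} → Star Arcˢ u v → Star Arc (contract u) (contract v)
    contractWalk = kleisliStar contract (λ {u} {v} → proj₁ ∘ arcˢ⇒≺ˢ {u} {v})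

    IsNew : V ⊎ Fin t → Set
    IsNew v = ∃[ i ] v ≡ inj₂ i

    isNew? : ∀ v → Dec (IsNew v)
    isNew? (inj₁ u) = no λ ()
    isNew? (inj₂ i) = yes (i , refl)

    isOld : ∀ v → ¬ IsNew v → v ≡ inj₁ (contract v)
    isOld (inj₁ u) _   = refl
    isOld (inj₂ i) old = ⊥-elim (old (i , refl))

    -- A shortcut on old vertices alone would be a shortcut of the deletion.
    meetsNewPath : (s : Shortcut Arcˢ) → ∃[ i ] IsNew (DirectedPath.vertex (Shortcut.path s) i)
    meetsNewPath s with any? (λ i → isNew? (DirectedPath.vertex (Shortcut.path s) i))
    ... | yes p  = p
    ... | no ¬p = ⊥-elim (delete-noShortcut record
      { k             = k
      ; path          = record
        { vertex   = contract ∘ vertex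
        ; distinct = λ {i} {j} eq → distinct (trans (old i) (trans (cong inj₁ eq) (sym (old j))))
        ; step     = λ i j → restrict {i} {j} ∘ step i j
        }
      ; atLeast4      = atLeast4
      ; shortcutEdge  = restrict {zero} {fromℕ k} shortcutEdge
      ; nonTransitive = λ tr → nonTransitive λ {i} {j} {l} i≢j j≢l i≢l a b →
          subst₂ Arcˢ (sym (old i)) (sym (old l)) (tr i≢j j≢l i≢l (restrict {i} {j} a) (restrict {j} {l} b))
      })
      where
      open Shortcut s
      open DirectedPath path
      old : ∀ i → vertex i ≡ inj₁ (contract (vertex i))
      old i = isOld (vertex i) λ q → ¬p (i , q)
      restrict : ∀ {i j} → Arcˢ (vertex i) (vertex j) → Arcᵈ (contract (vertex i)) (contract (vertex j))
      restrict {i} {j} = subst₂ Arcˢ (old i) (old j)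

    subdivide-semiTransitive : ¬ Shortcut Arcˢ → SemiTransitive subdivideOrientation
    subdivide-semiTransitive noShortcutˢ = record
      { acyclic    = strictOrder⇒acyclic _≺ˢ_
          (λ {u} {v} {w} → ≺ˢ-trans {u} {v} {w}) (λ {u} → ≺ˢ-irrefl {u}) (λ {u} {v} → arcˢ⇒≺ˢ {u} {v})
      ; noShortcut = noShortcutˢ
      }

  ≡1+⇒< : ∀ {a b} → b ≡ suc a → a < b
  ≡1+⇒< refl = ℕ.n<1+n _

  -- The new path directed from x to y, for the case of a middle vertex.

  module Ascending (t : ℕ) where

    open Subdivide t (λ a b → b ≡ suc a) _<_ inj₁ inj₁ ℕ.<-trans (ℕ.<-irrefl refl) ≡1+⇒< public

    -- The collapse to the other end: a walk reaching a new vertex becomes a walk to x, while under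
    -- `contract` a walk leaving a new vertex becomes a walk from y.
    contractˡ : V ⊎ Fin t → V
    contractˡ (inj₁ u) = u
    contractˡ (inj₂ _) = x

    arcˢ⇒contractˡ : ∀ {u v} → Arcˢ u v → Star Arc (contractˡ u) (contractˡ v)
    arcˢ⇒contractˡ {inj₁ u} {inj₁ v} (a , _)           = return a
    arcˢ⇒contractˡ {inj₁ u} {inj₂ i} (inj₁ (refl , _)) = ε
    arcˢ⇒contractˡ {inj₁ u} {inj₂ i} (inj₂ (_ , eq))   = ⊥-elim (t≢1+ i eq)
    arcˢ⇒contractˡ {inj₂ i} {inj₁ u} (refl , _)        = return xy
    arcˢ⇒contractˡ {inj₂ i} {inj₂ j} _                 = ε

    arc-into-new : ∀ {u m} → Arcˢ u (inj₂ m) →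
      (u ≡ inj₁ x × toℕ m ≡ 0) ⊎ (∃[ i ] u ≡ inj₂ i × toℕ m ≡ suc (toℕ i))
    arc-into-new {inj₁ u}     (inj₁ (refl , m≡0)) = inj₁ (refl , m≡0)
    arc-into-new {inj₁ u} {m} (inj₂ (_ , eq))     = ⊥-elim (t≢1+ m eq)
    arc-into-new {inj₂ i}     eq                  = inj₂ (i , refl , eq)

    arc-from-new : ∀ {m v} → Arcˢ (inj₂ m) v →
      (v ≡ inj₁ y × t ≡ suc (toℕ m)) ⊎ (∃[ j ] v ≡ inj₂ j × toℕ j ≡ suc (toℕ m))
    arc-from-new {m} {inj₁ v} (refl , eq) = inj₁ (refl , eq)
    arc-from-new {m} {inj₂ j} eq          = inj₂ (j , refl , eq)

    -- This keeps new vertices from ending a shortcut, whose last vertex receives arcs from both the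
    -- first and the penultimate vertex.
    into-new-unique : ∀ {u u′ m} → Arcˢ u (inj₂ m) → Arcˢ u′ (inj₂ m) → u ≡ u′
    into-new-unique {u} {u′} a a′ with arc-into-new {u} a | arc-into-new {u′} a′
    ... | inj₁ (refl , _)     | inj₁ (refl , _)      = refl
    ... | inj₁ (_ , m≡0)      | inj₂ (_ , _ , m≡1+i) with () ← trans (sym m≡0) m≡1+i
    ... | inj₂ (_ , _ , m≡1+i) | inj₁ (_ , m≡0)      with () ← trans (sym m≡0) m≡1+i
    ... | inj₂ (_ , refl , eq) | inj₂ (_ , refl , eq′) =
      cong inj₂ (toℕ-injective (ℕ.suc-injective (trans (sym eq) eq′)))

    -- Dually, this keeps new vertices from starting a shortcut, whose first vertex sends arcs to
    -- both the second and the last vertex.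
    from-new-unique : ∀ {m v v′} → Arcˢ (inj₂ m) v → Arcˢ (inj₂ m) v′ → v ≡ v′
    from-new-unique {m} {v} {v′} a a′ with arc-from-new {m} {v} a | arc-from-new {m} {v′} a′
    ... | inj₁ (refl , _)     | inj₁ (refl , _)      = refl
    ... | inj₁ (_ , t≡1+m)      | inj₂ (j , _ , j≡1+m) = ⊥-elim (ℕ.<-irrefl (trans j≡1+m (sym t≡1+m)) (toℕ<n j))
    ... | inj₂ (j , _ , j≡1+m) | inj₁ (_ , t≡1+m)      = ⊥-elim (ℕ.<-irrefl (trans j≡1+m (sym t≡1+m)) (toℕ<n j))
    ... | inj₂ (_ , refl , eq) | inj₂ (_ , refl , eq′) = cong inj₂ (toℕ-injective (trans eq (sym eq′)))

    noShortcutˢ : ∀ {w} → Arc x w → Arc w y → ¬ Shortcut Arcˢ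
    -- Matching on `atLeast4` exposes the number of arcs as `suc (suc k)`, which makes the second
    -- index differ from the last and the penultimate from zero by computation.
    noShortcutˢ xw wy s@(record { path = p ; atLeast4 = s≤s (s≤s (s≤s {n = k} _)) ; shortcutEdge = fl })
      with meetsNewPath s
    ... | i , j , vi≡pj = oldEnds (isNew? (first p)) (isNew? (last p))
      where
      open DirectedPath
      penultimate = inject₁ (fromℕ (suc k))
      oldEnds : Dec (IsNew (first p)) → Dec (IsNew (last p)) → ⊥
      oldEnds (yes (m , first≡)) _ with () ← distinct p {suc zero} {fromℕ _} (from-new-unique
        (subst (λ u → Arcˢ u (vertex p (suc zero))) first≡ (step p zero (suc zero) refl))
        (subst (λ u → Arcˢ u (last p)) first≡ fl))
      oldEnds _ (yes (m , last≡)) with () ← distinct p {zero} {penultimate} (into-new-unique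
        (subst (Arcˢ (first p)) last≡ fl)
        (subst (Arcˢ (vertex p penultimate)) last≡
          (step p penultimate (fromℕ _) (cong suc (sym (Fin.toℕ-inject₁ (fromℕ (suc k))))))))
      -- The shortcut passes through a new vertex, so its two halves collapse to walks into x and
      -- out of y, and its edge would be e.
      oldEnds (no firstOld) (no lastOld) = arcᵈ≢e ab (noOuterArc xw wy a⇝x y⇝b (proj₁ ab))
        where
        ab : Arcᵈ (contract (first p)) (contract (last p))
        ab = subst₂ Arcˢ (isOld (first p) firstOld) (isOld (last p) lastOld) fl
        y⇝b : Star Arc y (contract (last p))
        y⇝b = subst (λ u → Star Arc (contract u) (contract (last p))) vi≡pj (contractWalk (last-walk p i))
        a⇝x : Star Arc (contract (first p)) x
        a⇝x = subst₂ (λ u v → Star Arc (contractˡ u) (contractˡ v)) (isOld (first p) firstOld) vi≡pj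
          (kleisliStar contractˡ (λ {u} {v} → arcˢ⇒contractˡ {u} {v}) (first-walk p i))

  -- The new path directed from both ends towards p₁, for the case of no middle vertex.

  module Descending (t : ℕ) where

    open Subdivide t (λ a b → a ≡ suc b) _>_ inj₂ inj₂ (flip ℕ.<-trans) (ℕ.<-irrefl refl) ≡1+⇒< public

    -- Arcs out of a new vertex only lower the position, and y has the highest one.
    walk-from-new : ∀ {m v} → Star Arcˢ (inj₂ m) v → IsNew v
    walk-from-new ε = _ , refl
    walk-from-new {m} (_◅_ {j = inj₁ u} (_ , m≡1+t) s) = ⊥-elim (t≢1+ m m≡1+t)
    walk-from-new     (_◅_ {j = inj₂ i} _           s) = walk-from-new s

    arc-into-new : ∀ {u m} → Arcˢ u (inj₂ m) →
      (u ≡ inj₁ x × toℕ m ≡ 0) ⊎ (contract u ≡ y × position u ≡ suc (toℕ m))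
    arc-into-new {inj₁ u} (inj₁ (refl , m≡0)) = inj₁ (refl , m≡0)
    arc-into-new {inj₁ u} (inj₂ eqs)          = inj₂ eqs
    arc-into-new {inj₂ i} eq                  = inj₂ (refl , eq)

    arc-from-x : ∀ {v} → Arcˢ (inj₁ x) v →
      (∃[ w ] v ≡ inj₁ w × Arcᵈ x w) ⊎ (∃[ i ] v ≡ inj₂ i × toℕ i ≡ 0)
    arc-from-x {inj₁ w} a                = inj₁ (w , refl , a)
    arc-from-x {inj₂ i} (inj₁ (_ , i≡0)) = inj₂ (i , refl , i≡0)
    arc-from-x {inj₂ i} (inj₂ (x≡y , _)) = ⊥-elim (arc⇒≢ xy x≡y)

    noShortcutˢ : ¬ (∃[ w ] Arc x w × Arc w y) → ¬ Shortcut Arcˢ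
    noShortcutˢ noMiddle s@(record { path = p ; atLeast4 = s≤s (s≤s (s≤s {n = k} _)) ; shortcutEdge = fl })
      with meetsNewPath s
    ... | i , j , vi≡pj
      with walk-from-new (subst (λ u → Star Arcˢ u (DirectedPath.last p)) vi≡pj (last-walk p i))
    ... | m , last≡
      with arc-into-new {DirectedPath.first p} (subst (Arcˢ (DirectedPath.first p)) last≡ fl)
    -- Here the shortcut goes from x to p₁. Its second vertex is either an old w, giving a detour
    -- from x to y, or p₁ itself, repeating the last vertex.
    ... | inj₁ (first≡ , m≡0) = startsAtX (arc-from-x (subst (λ u → Arcˢ u second) first≡ (step zero (suc zero) refl)))
      where
      open DirectedPath p
      second = vertex (suc zero)
      startsAtX : (∃[ w ] second ≡ inj₁ w × Arcᵈ x w) ⊎ (∃[ i ] second ≡ inj₂ i × toℕ i ≡ 0) → ⊥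
      startsAtX (inj₁ (w , second≡ , xw)) =
        noDetour xy noMiddle (proj₁ xw)
          (subst₂ (λ u v → Star Arc (contract u) (contract v)) second≡ last≡
            (contractWalk (last-walk p (suc zero))))
          (λ w≡y → arcᵈ≢e xw (refl , w≡y))
      startsAtX (inj₂ (i , second≡ , i≡0))
        with () ← distinct {suc zero} {fromℕ _}
          (trans second≡ (trans (cong inj₂ (toℕ-injective (trans i≡0 (sym m≡0)))) (sym last≡)))
    -- Here the first and last vertices both contract to y, hence so does the second. Its position
    -- would lie strictly between `suc (toℕ m)` and `toℕ m`.
    ... | inj₂ (first≡y , first≡1+m) =
      ℕ.<⇒≱ (proj₂ second≺last (trans (sym eq) (trans first≡y (sym last≡y))))
        (ℕ.≤-trans (s≤s⁻¹ (subst (position second <_) first≡1+m (proj₂ first≺second eq)))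
          (ℕ.≤-reflexive (sym (cong position last≡))))
      where
      open DirectedPath p
      second = vertex (suc zero)
      last≡y : contract last ≡ y
      last≡y = cong contract last≡
      ordered : ∀ {i j} → toℕ i < toℕ j → vertex i ≺ˢ vertex j
      ordered = path-related _≺ˢ_ (λ {u} {v} {w} → ≺ˢ-trans {u} {v} {w}) (λ {u} {v} → arcˢ⇒≺ˢ {u} {v}) p
      first≺second : first ≺ˢ second
      first≺second = ordered {zero} {suc zero} z<s
      second≺last : second ≺ˢ last
      second≺last = ordered {suc zero} {fromℕ _} (s<s z<s)
      eq : contract first ≡ contract second
      eq = walk-antisym (proj₁ first≺second)
        (subst (Star Arc (contract second)) (trans last≡y (sym first≡y)) (proj₁ second≺last))

  -- Choice of the orientation and conclusion.

  subdivide-orientable : ∀ t → SemiTransitivelyOrientable (subdivide G e t)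
  subdivide-orientable t with ∃? {G = G} (λ w → arc? φ x w ×-dec arc? φ w y)
  ... | yes (w , xw , wy) = subdivideOrientation , subdivide-semiTransitive (noShortcutˢ xw wy)
    where open Ascending t
  ... | no noMiddle       = subdivideOrientation , subdivide-semiTransitive (noShortcutˢ noMiddle)
    where open Descending t

theorem1p12 : {V : Set} (G : Graph V) (e : Edge G) →
    SemiTransitivelyOrientable G →
    ¬ (Σ[ S ∈ Subgraph G ] (S ≅ K 4 × e ∈ᴱ S)) →
    SemiTransitivelyOrientable (delete G e) ×
    ((t : ℕ) → 1 ≤ t → SemiTransitivelyOrientable (subdivide G e t))
theorem1p12 G e (φ , φ-st) noK₄ with Orientation.orient φ (Edge.adj e)
... | inj₁ xy = (deleteOrientation , delete-semiTransitive) , λ t _ → subdivide-orientable t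
  where open DeleteSubdivide e φ-st xy noK₄
-- In the converse orientation, `yx` is an arc from x to y.
... | inj₂ yx = (deleteOrientation , delete-semiTransitive) , λ t _ → subdivide-orientable t
  where open DeleteSubdivide e {converse φ} (SemiTransitiveProperties.converse-semiTransitive φ-st) yx noK₄
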